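{- Let $G$ and $H$ be simple connected graphs, each with at least two vertices. Then the Kronecker product $G \otimes H$ is not isomorphic to the strong product $G \boxtimes H$.
   Context: All graphs are finite, undirected and simple (no loops or multiple edges). For graphs $G$ and $H$, the following products have vertex set $V(G)\times V(H)$. The Kronecker (direct) product $G\otimes H$: $(x,y)\sim(x',y')$ if $x\sim x'$ in $G$ and $y\sim y'$ in $H$. The strong product $G\boxtimes H$: $(x,y)\sim(x',y')$ if either ($x\sim x'$ in $G$ and $y=y'$) or ($x=x'$ and $y\sim y'$ in $H$) or ($x\sim x'$ in $G$ and $y\sim y'$ in $H$). Two graphs are isomorphic if there is a bijection between their vertex sets that preserves adjacency and non-adjacency. -}

module Defs where

open import Data.Fin using (Fin)
open import Data.Fin.Properties using (inj⇒≟; *↔×)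
open import Data.Nat using (ℕ; _*_)
open import Data.Product using (_×_; _,_)
open import Data.Product.Function.NonDependent.Propositional using (_×-↔_)
open import Data.Sum using (_⊎_; inj₁; inj₂)
open import Function using (_↔_; Inverse)
open import Function.Construct.Composition using (_↔-∘_)
open import Function.Construct.Symmetry using (↔-sym)
open import Function.Properties.Inverse using (↔⇒↣)
open import Level using (0ℓ)
open import Relation.Binary.Construct.Closure.ReflexiveTransitive using (Star)
open import Relation.Binary.Core using (Rel)
open import Relation.Binary.Definitions using (Decidable; DecidableEquality; Symmetric)
open import Relation.Binary.PropositionalEquality using (_≡_; sym)
open import Relation.Nullary using (¬_; _×-dec_; _⊎-dec_)

-- Adjacency is required to be decidable, as is automatic for a finite graph
-- in classical mathematics.  Having no loops is `irrefl`; multiple edges are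
-- excluded because edges are given by a relation (its proofs are never counted).
record Graph : Set₁ where
  field
    Vertex : Set
    order  : ℕ
    finite : Vertex ↔ Fin order
    Adj    : Rel Vertex 0ℓ
    adj?   : Decidable Adj
    symm   : Symmetric Adj
    irrefl : ∀ {x} → ¬ Adj x x

  _≟_ : DecidableEquality Vertex
  _≟_ = inj⇒≟ (↔⇒↣ finite)

open Graph public using (Vertex; order; Adj)

-- Elements of `Star (Adj G) x y` are the walks from x to y.  Under this
-- definition the graph without vertices counts as connected.
Connected : Graph → Set
Connected G = ∀ (x y : Vertex G) → Star (Adj G) x y

infix 4 _≅_

record _≅_ (G H : Graph) : Set where
  field
    bijection : Vertex G ↔ Vertex H

  open Inverse bijection public using (to; from)

  field
    adj    : ∀ {x y} → Adj G x y → Adj H (to x) (to y)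
    nonadj : ∀ {x y} → ¬ Adj G x y → ¬ Adj H (to x) (to y)

module _ (G H : Graph) where

  private
    module G = Graph G
    module H = Graph H

    finite-× : (G.Vertex × H.Vertex) ↔ Fin (G.order * H.order)
    finite-× = ↔-sym *↔× ↔-∘ (G.finite ×-↔ H.finite)

  infixr 7 _⊗_ _⊠_

  _⊗_ : Graph
  _⊗_ = record
    { Vertex = G.Vertex × H.Vertex
    ; order  = G.order * H.order
    ; finite = finite-×
    ; Adj    = λ (x , y) (x′ , y′) → G.Adj x x′ × H.Adj y y′
    ; adj?   = λ (x , y) (x′ , y′) → G.adj? x x′ ×-dec H.adj? y y′
    ; symm   = λ (p , q) → G.symm p , H.symm q
    ; irrefl = λ (p , _) → G.irrefl p
    }

  _⊠_ : Graph
  _⊠_ = record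
    { Vertex = G.Vertex × H.Vertex
    ; order  = G.order * H.order
    ; finite = finite-×
    ; Adj    = λ (x , y) (x′ , y′) →
                 (G.Adj x x′ × y ≡ y′) ⊎ (x ≡ x′ × H.Adj y y′) ⊎ (G.Adj x x′ × H.Adj y y′)
    ; adj?   = λ (x , y) (x′ , y′) →
                 (G.adj? x x′ ×-dec (y H.≟ y′)) ⊎-dec
                 ((x G.≟ x′) ×-dec H.adj? y y′) ⊎-dec
                 (G.adj? x x′ ×-dec H.adj? y y′)
    ; symm   = λ where
        (inj₁ (p , e))        → inj₁ (G.symm p , sym e)
        (inj₂ (inj₁ (e , q))) → inj₂ (inj₁ (sym e , H.symm q))
        (inj₂ (inj₂ (p , q))) → inj₂ (inj₂ (G.symm p , H.symm q))
    ; irrefl = λ where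
        (inj₁ (p , _))        → G.irrefl p
        (inj₂ (inj₁ (_ , q))) → H.irrefl q
        (inj₂ (inj₂ (p , _))) → G.irrefl p
    }

{-# OPTIONS --safe #-}
module Submission where

-- On a finite set an injective map f has every point on a cycle, so if f maps
-- Q into a subset P of Q, then P = Q.  An isomorphism G ⊗ H ≅ G ⊠ H acts in
-- this way on the pairs of vertices of G × H: it maps the non-edges of G ⊗ H
-- to non-edges of G ⊠ H, all of which are non-edges of G ⊗ H.  But if x ∼ x′
-- in G, then (x , y) and (x′ , y) are adjacent in G ⊠ H and not in G ⊗ H.

open import Defs
open import Data.Fin using (Fin; zero; suc; toℕ; fromℕ<)
open import Data.Fin.Properties using (pigeonhole)
open import Data.Nat using (zero; suc; _≤_; _<_; s≤s; s<s⁻¹)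
open import Data.Nat.GeneralisedArithmetic using (fold)
open import Data.Nat.Properties using (<⇒≤; n<1+n)
open import Data.Product using (_×_; _,_; ∃; ∃₂; map)
open import Data.Product.Function.NonDependent.Propositional using (_×-↔_)
open import Data.Sum using (inj₁; inj₂)
open import Function using (_↔_; Inverse; Injective; Injection)
open import Function.Construct.Symmetry using (↔-sym)
open import Function.Properties.Inverse using (↔⇒↣)
open import Level using (0ℓ)
open import Relation.Binary.Construct.Closure.ReflexiveTransitive using (ε; _◅_)
open import Relation.Binary.PropositionalEquality using (_≡_; _≢_; refl; sym; subst)
open import Relation.Nullary using (¬_; contradiction)
open import Relation.Unary using (Pred; _⊆_)

↔-injective : ∀ {A B : Set} (A↔B : A ↔ B) → Injective _≡_ _≡_ (Inverse.to A↔B)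
↔-injective A↔B = Injection.injective (↔⇒↣ A↔B)

module _ {A : Set} {f : A → A} (f-injective : Injective _≡_ _≡_ f) where

  -- Injectivity strips one `f` from both sides until the left side is `a`; the right side then
  -- carries `j - i` applications, which is `suc k`.
  fold-cancel : ∀ {a i j} → i < j → fold a f i ≡ fold a f j →
                ∃ λ k → fold a f (suc k) ≡ a
  fold-cancel {i = zero}  {suc j} _   eq = j , sym eq
  fold-cancel {i = suc i} {suc j} i<j eq = fold-cancel (s<s⁻¹ i<j) (f-injective eq)

  module _ {n} (finite : A ↔ Fin n) where

    periodic : ∀ a → ∃ λ k → fold a f (suc k) ≡ a
    periodic a
      -- The `n + 1` iterates with exponents `0` to `n` cannot all differ.
      with pigeonhole (n<1+n n) (λ i → Inverse.to finite (fold a f (toℕ i)))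
    ... | _ , _ , i<j , eq = fold-cancel i<j (↔-injective finite eq)

    -- The whole orbit of `a` stays in `Q`. Since the period `suc k` is positive, `a` is itself the
    -- image of a point of `Q`, hence in `P`.
    image⊆subset⇒⊆ : ∀ {P Q : Pred A 0ℓ} → P ⊆ Q → (∀ {a} → Q a → P (f a)) → Q ⊆ P
    image⊆subset⇒⊆ {P} {Q} P⊆Q fQ⊆P {a} qa with periodic a
    ... | k , eq = subst P eq (fQ⊆P (Q-fold k))
      where
      Q-fold : ∀ k → Q (fold a f k)
      Q-fold zero    = qa
      Q-fold (suc k) = P⊆Q (fQ⊆P (Q-fold k))

module _ (G : Graph) where

  vertex : 1 ≤ order G → Vertex G
  vertex 1≤n = Inverse.from (Graph.finite G) (fromℕ< 1≤n)

  distinct-vertices : 2 ≤ order G → ∃₂ λ (x y : Vertex G) → x ≢ y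
  -- With `order G` abstracted together with its bijection, matching on `2≤n` makes the index
  -- `suc (suc _)`.
  distinct-vertices 2≤n with order G | Graph.finite G
  distinct-vertices (s≤s (s≤s _)) | _ | finite =
    from zero , from (suc zero) , λ eq → 0≢1 (↔-injective (↔-sym finite) eq)
    where
    open Inverse finite
    0≢1 : ∀ {n} → Fin.zero {suc n} ≢ suc zero
    0≢1 ()

  -- A walk between distinct vertices is nonempty; its first step is an edge.
  edge : Connected G → 2 ≤ order G → ∃₂ (Adj G)
  edge connected 2≤n with distinct-vertices 2≤n
  ... | x , y , x≢y with connected x y
  ...   | ε        = contradiction refl x≢y
  ...   | x∼z ◅ _ = x , _ , x∼z

theorem3p6 : (G H : Graph) → Connected G → Connected H →
    2 ≤ order G → 2 ≤ order H → ¬ ((G ⊗ H) ≅ (G ⊠ H))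
theorem3p6 G H G-connected _ 2≤|G| 2≤|H| iso with edge G G-connected 2≤|G|
... | x , x′ , x∼x′ =
  image⊆subset⇒⊆ {f = map to to} map-injective finite-pairs
    {P = λ (u , v) → ¬ Adj (G ⊠ H) u v} {Q = λ (u , v) → ¬ Adj (G ⊗ H) u v}
    (λ u≁v u∼v → u≁v (inj₂ (inj₂ u∼v))) nonadj
    {(x , y) , (x′ , y)} (λ (_ , y∼y) → Graph.irrefl H y∼y)
    (inj₁ (x∼x′ , refl))
  where
  open _≅_ iso

  y : Vertex H
  y = vertex H (<⇒≤ 2≤|H|)

  -- Pairs of vertices are the vertices of a Kronecker square, which is finite as a graph.
  finite-pairs : (Vertex (G ⊗ H) × Vertex (G ⊗ H)) ↔ Fin _
  finite-pairs = Graph.finite ((G ⊗ H) ⊗ (G ⊗ H))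

  map-injective : Injective _≡_ _≡_ (map to to)
  map-injective = ↔-injective (bijection ×-↔ bijection)
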